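{- Let $r,s,t$ be integers with $1\le r\le s\le t$ and $n=r+s+t+1$. Then the $(2r+1)$-fault diameter of the exchanged 3-ary $n$-cube satisfies $D^{f}_{2r+1}(E3C(r,s,t))\ge r+s+t+4=n+3$.
   Context: The exchanged 3-ary $n$-cube $E3C(r,s,t)$ ($r,s,t\ge1$, $n=r+s+t+1$): vertices are strings $x=x[r+s+t]\cdots x[1]x[0]$ with all $x[i]\in\{0,1,2\}$, written $x=ABCd$ where $A=x[r+s+t]\cdots x[s+t+1]\in\{0,1,2\}^r$, $B=x[s+t]\cdots x[t+1]\in\{0,1,2\}^s$, $C=x[t]\cdots x[1]\in\{0,1,2\}^t$, $d=x[0]$. Two distinct vertices $x=ABCd$, $y=A'B'C'd'$ are adjacent iff one of: (E0) $A=A',B=B',C=C'$ and $d\ne d'$; (E1) $d=d'=0$, $A=A'$, $B=B'$ and $C,C'$ differ in exactly one position; (E2) $d=d'=1$, $A=A'$, $C=C'$ and $B,B'$ differ in exactly one position; (E3) $d=d'=2$, $B=B'$, $C=C'$ and $A,A'$ differ in exactly one position. For a connected graph $G$ and positive integer $\alpha\le\kappa(G)-1$ ($\kappa$ = vertex connectivity), the $\alpha$-fault diameter is $D^f_\alpha(G)=\max\{d_{G-F}(u,v): u\ne v\in V(G),\ F\subseteq V(G)\setminus\{u,v\},\ |F|=\alpha\}$, where $d_{G-F}$ is the shortest-path distance in $G-F$. (It is known that $\kappa(E3C(r,s,t))=2r+2$ when $r\le s\le t$.) -}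

module Defs where

open import Data.Fin using (Fin)
open import Data.Fin.Patterns using (0F; 1F; 2F)
open import Data.List using (List; length)
open import Data.List.Membership.Propositional using (_∉_)
open import Data.List.Relation.Unary.Unique.Propositional using (Unique)
open import Data.Nat using (ℕ; zero; suc; _≤_)
open import Data.Product using (Σ; ∃!; _×_; _,_; proj₁)
open import Data.Vec using (Vec; lookup)
open import Relation.Binary.Definitions using (Symmetric)
open import Relation.Binary.PropositionalEquality using (_≡_; _≢_; refl; sym)
open import Relation.Nullary using (¬_)

record Graph : Set₁ where
  field
    Vertex : Set
    Adj    : Vertex → Vertex → Set
    symm   : Symmetric Adj
    irrefl : ∀ {v} → ¬ Adj v v

_∖_ : (G : Graph) → List (Graph.Vertex G) → Graph
G ∖ F = record
  { Vertex = Σ Vertex (_∉ F)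
  ; Adj    = λ u v → Adj (proj₁ u) (proj₁ v)
  ; symm   = symm
  ; irrefl = irrefl
  }
  where open Graph G

data Walk (G : Graph) : Graph.Vertex G → Graph.Vertex G → ℕ → Set where
  nil  : ∀ {u} → Walk G u u zero
  cons : ∀ {u w v k} → Graph.Adj G u w → Walk G w v k → Walk G u v (suc k)

-- A walk of minimum length repeats no vertex, so k is the length of a shortest
-- path.  No k qualifies when u and v are not connected.
IsDistance : (G : Graph) → Graph.Vertex G → Graph.Vertex G → ℕ → Set
IsDistance G u v k = Walk G u v k × (∀ l → Walk G u v l → k ≤ l)

-- F is a duplicate-free list, so its cardinality is its length.
FaultDistance : Graph → ℕ → ℕ → Set
FaultDistance G α k =
  Σ Vertex λ u → Σ Vertex λ v → u ≢ v ×
  Σ (List Vertex) λ F → Unique F × length F ≡ α ×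
  Σ (u ∉ F) λ u∉F → Σ (v ∉ F) λ v∉F →
  IsDistance (G ∖ F) (u , u∉F) (v , v∉F) k
  where open Graph G

IsMaximum : (ℕ → Set) → ℕ → Set
IsMaximum S m = S m × (∀ k → S k → k ≤ m)

-- For α at most κ(G) - 1 every G ∖ F above is connected, so every admissible
-- triple (u , v , F) contributes a distance to the maximum.
IsFaultDiameter : Graph → ℕ → ℕ → Set
IsFaultDiameter G α = IsMaximum (FaultDistance G α)

DifferInExactlyOne : ∀ {m} → Vec (Fin 3) m → Vec (Fin 3) m → Set
DifferInExactlyOne X Y = ∃! _≡_ λ i → lookup X i ≢ lookup Y i

record E3CVertex (r s t : ℕ) : Set where
  constructor ⟨_,_,_,_⟩
  field
    A : Vec (Fin 3) r
    B : Vec (Fin 3) s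
    C : Vec (Fin 3) t
    d : Fin 3

data E3CAdj {r s t : ℕ} : E3CVertex r s t → E3CVertex r s t → Set where
  E0 : ∀ {A B C d d′} → d ≢ d′ → E3CAdj ⟨ A , B , C , d ⟩ ⟨ A , B , C , d′ ⟩
  E1 : ∀ {A B C C′} → DifferInExactlyOne C C′ → E3CAdj ⟨ A , B , C , 0F ⟩ ⟨ A , B , C′ , 0F ⟩
  E2 : ∀ {A B B′ C} → DifferInExactlyOne B B′ → E3CAdj ⟨ A , B , C , 1F ⟩ ⟨ A , B′ , C , 1F ⟩
  E3 : ∀ {A A′ B C} → DifferInExactlyOne A A′ → E3CAdj ⟨ A , B , C , 2F ⟩ ⟨ A′ , B , C , 2F ⟩

differ-sym : ∀ {m} (X Y : Vec (Fin 3) m) → DifferInExactlyOne X Y → DifferInExactlyOne Y X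
differ-sym _ _ (i , Xi≢Yi , unique) = i , (λ e → Xi≢Yi (sym e)) , λ Yj≢Xj → unique (λ e → Yj≢Xj (sym e))

differ-irrefl : ∀ {m} (X : Vec (Fin 3) m) → ¬ DifferInExactlyOne X X
differ-irrefl _ (_ , Xi≢Xi , _) = Xi≢Xi refl

E3CAdj-sym : ∀ {r s t} → Symmetric (E3CAdj {r} {s} {t})
E3CAdj-sym (E0 d≢d′) = E0 (λ e → d≢d′ (sym e))
E3CAdj-sym (E1 {C = C} {C′ = C′} p) = E1 (differ-sym C C′ p)
E3CAdj-sym (E2 {B = B} {B′ = B′} p) = E2 (differ-sym B B′ p)
E3CAdj-sym (E3 {A = A} {A′ = A′} p) = E3 (differ-sym A A′ p)

E3CAdj-irrefl : ∀ {r s t} {v : E3CVertex r s t} → ¬ E3CAdj v v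
E3CAdj-irrefl (E0 d≢d) = d≢d refl
E3CAdj-irrefl (E1 {C = C} p) = differ-irrefl C p
E3CAdj-irrefl (E2 {B = B} p) = differ-irrefl B p
E3CAdj-irrefl (E3 {A = A} p) = differ-irrefl A p

E3C : ℕ → ℕ → ℕ → Graph
E3C r s t = record
  { Vertex = E3CVertex r s t
  ; Adj    = E3CAdj
  ; symm   = E3CAdj-sym
  ; irrefl = E3CAdj-irrefl
  }

{-# OPTIONS --safe #-}

-- Let u = (0⋯0, 0⋯0, 0⋯0, 2) and v = (1⋯1, 1⋯1, 1⋯1, 2), and delete every
-- neighbour of u except w = (20⋯0, 0⋯0, 0⋯0, 2).  A path from u to v starts with
-- the step to w, which still disagrees with v in all r + s + t coordinates of the
-- three blocks.  From w each of these coordinates costs one step, and the last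
-- digit has to leave 2, visit both 0 and 1 and return, which costs three more;
-- hence the distance is exactly r + s + t + 4.  The maximum defining the fault
-- diameter exists because fault distances are decidable and smaller than the
-- number of vertices.
module Submission where

open import Defs
open import Data.Fin as Fin using (Fin; zero; suc; toℕ)
open import Data.Fin.Patterns using (0F; 1F; 2F)
open import Data.Fin.Properties as Fin using (any?; all?; injective⇒≤; toℕ-injective; *↔×)
open import Data.List using (List; []; _∷_; length; map)
open import Data.List.Membership.Propositional using (_∈_; _∉_)
open import Data.List.Membership.Propositional.Properties using (∈-map⁺; ∈-map⁻)
open import Data.List.Properties using (length-map)
open import Data.List.Relation.Unary.All as All using ([]; _∷_)
import Data.List.Relation.Unary.All.Properties as All
open import Data.List.Relation.Unary.AllPairs as AllPairs using ([]; _∷_; allPairs?)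
open import Data.List.Relation.Unary.Any as Any using (here; there)
open import Data.List.Relation.Unary.Unique.Propositional using (Unique)
open import Data.List.Relation.Unary.Unique.Propositional.Properties using (map⁺)
open import Data.Nat using (ℕ; zero; suc; _+_; _*_; _≤_; _<_; _≥_; _⊓_; z≤n; s≤s)
open import Data.Nat.Properties hiding (_≟_)
open import Data.Nat.Tactic.RingSolver using (solve-∀)
open import Data.Product using (∃-syntax; ∃; _×_; _,_; map₂; proj₁; proj₂)
open import Data.Product.Function.NonDependent.Propositional using (_×-↔_)
open import Data.Sum using (inj₁; inj₂)
open import Data.Vec as Vec using (Vec; []; _∷_; lookup; replicate; toList; fromList)
import Data.Vec.Properties as Vec
open import Data.Vec.Relation.Binary.Pointwise.Extensional using (ext; Pointwise-≡⇒≡)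
open import Function using (_∘_; _↔_; mk↔ₛ′; Inverse; case_of_)
open import Function.Construct.Composition using (_↔-∘_)
open import Function.Construct.Identity using (↔-id)
open import Function.Construct.Symmetry using (↔-sym)
open import Relation.Binary.Definitions using (DecidableEquality; Decidable)
open import Relation.Binary.PropositionalEquality using (_≡_; _≢_; refl; sym; trans; cong; subst; module ≡-Reasoning)
open import Relation.Nullary using (Dec; yes; no; ¬?; contradiction)
open import Relation.Nullary.Decidable using (map′; _×-dec_; _⊎-dec_; _→-dec_; decidable-stable; from-yes)
import Relation.Unary as Unary

-- Dependent decisions and bounded maxima

_×-dec′_ : {P Q : Set} → Dec P → (P → Dec Q) → Dec (P × Q)
no ¬p ×-dec′ q? = no (¬p ∘ proj₁)
yes p ×-dec′ q? = map′ (p ,_) proj₂ (q? p)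

-- The search runs down from the bound. At bound 0 the known member `k` must itself be 0, so `S 0`
-- holds.
bounded-maximum : {S : ℕ → Set} → Unary.Decidable S →
                  ∀ {k} n → (∀ j → S j → j ≤ n) → S k → ∃ (IsMaximum S)
bounded-maximum {S} S? {k} zero bound Sk = 0 , subst S (n≤0⇒n≡0 (bound k Sk)) Sk , bound
bounded-maximum S? (suc n) bound Sk with S? (suc n)
... | yes Sn = suc n , Sn , bound
... | no ¬Sn = bounded-maximum S? n bound′ Sk
  where
  bound′ : ∀ j → _ → j ≤ n
  bound′ j Sj = ≤-pred (≤∧≢⇒< (bound j Sj) λ { refl → ¬Sn Sj })

-- Finite types

Finite : Set → Set
Finite A = ∃[ n ] (A ↔ Fin n)

finite-× : {A B : Set} → Finite A → Finite B → Finite (A × B)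
finite-× (m , A↔m) (n , B↔n) = m * n , (↔-sym *↔× ↔-∘ (A↔m ×-↔ B↔n))

finite-Vec : {A : Set} → Finite A → ∀ n → Finite (Vec A n)
finite-Vec A-finite zero = 1 , mk↔ₛ′ (λ _ → zero) (λ _ → []) (λ { zero → refl }) (λ { [] → refl })
finite-Vec A-finite (suc n) with finite-× A-finite (finite-Vec A-finite n)
... | m , A×Vec↔m =
  m , (A×Vec↔m ↔-∘ mk↔ₛ′ Vec.uncons (λ (x , xs) → x ∷ xs) (λ _ → refl) (λ { (_ ∷ _) → refl }))

module FiniteType {A : Set} (finite : Finite A) where
  open Inverse (proj₂ finite) public using () renaming (to to encode; from to decode; strictlyInverseʳ to decode-encode)

  encode-injective : ∀ {x y} → encode x ≡ encode y → x ≡ y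
  encode-injective {x} {y} eq = trans (sym (decode-encode x)) (trans (cong decode eq) (decode-encode y))

  _≟_ : DecidableEquality A
  x ≟ y = map′ encode-injective (cong encode) (encode x Fin.≟ encode y)

  search? : {P : A → Set} → Unary.Decidable P → Dec (∃ P)
  search? {P} P? = map′ (λ (i , p) → decode i , p)
                        (λ (x , p) → encode x , subst P (sym (decode-encode x)) p)
                        (any? (P? ∘ decode))

-- Lists of length `n` come from vectors of length `n`, so fixing the length makes the search
-- finite.
search-list? : {A : Set} → Finite A → {P : List A → Set} → Unary.Decidable P →
               ∀ n → Dec (∃[ xs ] (length xs ≡ n × P xs))
search-list? A-finite {P} P? n =
  map′ (λ (xs , p) → toList xs , Vec.length-toList xs , p)
       (λ { (xs , refl , p) → fromList xs , subst P (sym (Vec.toList∘fromList xs)) p })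
       (FiniteType.search? (finite-Vec A-finite n) (P? ∘ toList))

-- Fault distances in finite graphs

module FiniteGraph (G : Graph) (finite : Finite (Graph.Vertex G)) (adj? : Decidable (Graph.Adj G)) where
  open Graph G
  open FiniteType finite

  _∈?_ : (x : Vertex) (F : List Vertex) → Dec (x ∈ F)
  x ∈? F = Any.any? (x ≟_) F

  -- Vertices of G ∖ F carry a proof of x ∉ F, and such proofs are not known to be
  -- equal, so walks of G ∖ F are compared with walks through bare vertices of G.
  Reach : List Vertex → Vertex → Vertex → ℕ → Set
  Reach F u v zero    = u ≡ v
  Reach F u v (suc k) = ∃[ w ] (w ∉ F × Adj u w × Reach F w v k)

  reach? : ∀ F u v k → Dec (Reach F u v k)
  reach? F u v zero    = u ≟ v
  reach? F u v (suc k) = search? λ w → ¬? (w ∈? F) ×-dec adj? u w ×-dec reach? F w v k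

  walk⇒reach : ∀ {F u v k} → Walk (G ∖ F) u v k → Reach F (proj₁ u) (proj₁ v) k
  walk⇒reach nil = refl
  walk⇒reach (cons {w = w , w∉F} u~w walk) = w , w∉F , u~w , walk⇒reach walk

  -- Positive length matters: the last step can end in the given proof `v∉F`, whereas an empty walk
  -- would need `u∉F` and `v∉F` to be equal.
  reach⇒walk : ∀ {F u v} (u∉F : u ∉ F) (v∉F : v ∉ F) k →
               Reach F u v (suc k) → Walk (G ∖ F) (u , u∉F) (v , v∉F) (suc k)
  reach⇒walk u∉F v∉F zero    (w , _ , u~w , refl)    = cons u~w nil
  reach⇒walk u∉F v∉F (suc k) (w , w∉F , u~w , w⇝v) = cons u~w (reach⇒walk w∉F v∉F k w⇝v)

  reach⇒walk-≢ : ∀ {F u v} (u∉F : u ∉ F) (v∉F : v ∉ F) → u ≢ v → ∀ k →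
                 Reach F u v k → Walk (G ∖ F) (u , u∉F) (v , v∉F) k
  reach⇒walk-≢ u∉F v∉F u≢v zero    u≡v = contradiction u≡v u≢v
  reach⇒walk-≢ u∉F v∉F u≢v (suc k) u⇝v = reach⇒walk u∉F v∉F k u⇝v

  IsReachDistance : List Vertex → Vertex → Vertex → ℕ → Set
  IsReachDistance F u v k = Reach F u v k × (∀ l → Reach F u v l → k ≤ l)

  isReachDistance? : ∀ F u v k → Dec (IsReachDistance F u v k)
  isReachDistance? F u v k =
    reach? F u v k ×-dec
    -- Minimality over all lengths amounts to having no walk of length below `k`, which is a bounded
    -- check.
    map′ (λ none l u⇝v → ≮⇒≥ λ l<k → none l<k u⇝v)
         (λ minimal {l} l<k u⇝v → <⇒≱ l<k (minimal l u⇝v))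
         (allUpTo? (¬? ∘ reach? F u v) k)

  isDistance⇒isReachDistance : ∀ {F u v} (u∉F : u ∉ F) (v∉F : v ∉ F) → u ≢ v → ∀ {k} →
    IsDistance (G ∖ F) (u , u∉F) (v , v∉F) k → IsReachDistance F u v k
  isDistance⇒isReachDistance u∉F v∉F u≢v (walk , minimal) =
    walk⇒reach walk , λ l u⇝v → minimal l (reach⇒walk-≢ u∉F v∉F u≢v l u⇝v)

  isReachDistance⇒isDistance : ∀ {F u v} (u∉F : u ∉ F) (v∉F : v ∉ F) → u ≢ v → ∀ {k} →
    IsReachDistance F u v k → IsDistance (G ∖ F) (u , u∉F) (v , v∉F) k
  isReachDistance⇒isDistance u∉F v∉F u≢v {k} (u⇝v , minimal) =
    reach⇒walk-≢ u∉F v∉F u≢v k u⇝v , λ l walk → minimal l (walk⇒reach walk)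

  isReachDistance-unique : ∀ {F u v k l} → IsReachDistance F u v k → IsReachDistance F u v l → k ≡ l
  isReachDistance-unique (p , p-min) (q , q-min) = ≤-antisym (p-min _ q) (q-min _ p)

  -- A shorter walk from `w`, preceded by the edge from `u`, would beat the minimum at `u`.
  isReachDistance-tail : ∀ {F u v k} → IsReachDistance F u v (suc k) → ∃[ w ] IsReachDistance F w v k
  isReachDistance-tail ((w , w∉F , u~w , w⇝v) , minimal) =
    w , w⇝v , λ l w⇝′v → ≤-pred (minimal (suc l) (w , w∉F , u~w , w⇝′v))

  at-each-distance : ∀ {F u v} k → IsReachDistance F u v k →
                     ∀ {j} → j ≤ k → ∃[ x ] IsReachDistance F x v j
  at-each-distance {u = u} k dist {j} j≤k with m≤n⇒m<n∨m≡n j≤k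
  at-each-distance {u = u} k dist j≤k       | inj₂ refl = u , dist
  at-each-distance (suc k) dist j≤k | inj₁ (s≤s j≤k′) =
    at-each-distance k (proj₂ (isReachDistance-tail dist)) j≤k′

  -- Pigeonhole: every distance from 0 to `k` is attained by some vertex, and vertices at different
  -- distances from `v` are different.
  isReachDistance-bounded : ∀ {F u v k} → IsReachDistance F u v k → k < proj₁ finite
  isReachDistance-bounded {F} {u} {v} {k} dist = injective⇒≤ {f = encode ∘ proj₁ ∘ vertexAt} λ {i} {j} eq →
    toℕ-injective (isReachDistance-unique
      (subst (λ x → IsReachDistance F x v (toℕ i)) (encode-injective eq) (proj₂ (vertexAt i)))
      (proj₂ (vertexAt j)))
    where
    vertexAt : (i : Fin (suc k)) → ∃[ x ] IsReachDistance F x v (toℕ i)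
    vertexAt i = at-each-distance k dist (Fin.toℕ≤pred[n] i)

  faultDistance-bounded : ∀ α k → FaultDistance G α k → k ≤ proj₁ finite
  faultDistance-bounded α k (u , v , u≢v , F , _ , _ , u∉F , v∉F , dist) =
    <⇒≤ (isReachDistance-bounded (isDistance⇒isReachDistance u∉F v∉F u≢v dist))

  faultDistance? : ∀ α → Unary.Decidable (FaultDistance G α)
  -- The second decision must receive the proof of `u ≢ v`, which excludes walks of length 0 when
  -- passing from `Reach` back to `Walk`.
  faultDistance? α k = search? λ u → search? λ v → ¬? (u ≟ v) ×-dec′ λ u≢v →
    map′ (λ { (F , len , uniq , u∉F , v∉F , dist) →
              F , uniq , len , u∉F , v∉F , isReachDistance⇒isDistance u∉F v∉F u≢v dist })
         (λ { (F , uniq , len , u∉F , v∉F , dist) →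
              F , len , uniq , u∉F , v∉F , isDistance⇒isReachDistance u∉F v∉F u≢v dist })
         (search-list? finite
           (λ F → allPairs? (λ x y → ¬? (x ≟ y)) F ×-dec ¬? (u ∈? F) ×-dec ¬? (v ∈? F) ×-dec
                  isReachDistance? F u v k)
           α)

  faultDiameter-≥ : ∀ α {k} → FaultDistance G α k → ∃[ D ] (IsFaultDiameter G α D × D ≥ k)
  faultDiameter-≥ α {k} dist
    with bounded-maximum (faultDistance? α) (proj₁ finite) (faultDistance-bounded α) dist
  ... | D , D-max = D , D-max , proj₂ D-max k dist

-- Vectors differing in exactly one position

-- An inductive counterpart of `DifferInExactlyOne` that allows recursion along the vectors.
data OneChange : ∀ {m} → Vec (Fin 3) m → Vec (Fin 3) m → Set where
  here  : ∀ {m x y} {X : Vec (Fin 3) m} → x ≢ y → OneChange (x ∷ X) (y ∷ X)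
  there : ∀ {m x} {X Y : Vec (Fin 3) m} → OneChange X Y → OneChange (x ∷ X) (x ∷ Y)

differ⇒oneChange : ∀ {m} (X Y : Vec (Fin 3) m) → DifferInExactlyOne X Y → OneChange X Y
differ⇒oneChange (x ∷ X) (y ∷ Y) (zero , x≢y , unique) =
  subst (λ Z → OneChange (x ∷ X) (y ∷ Z)) X≡Y (here x≢y)
  where
  X≡Y : X ≡ Y
  -- A difference in the tail would identify `suc i` with the unique differing position `zero`.
  X≡Y = Pointwise-≡⇒≡ (ext λ i → decidable-stable (lookup X i Fin.≟ lookup Y i)
          λ Xi≢Yi → case unique {suc i} Xi≢Yi of λ ())
differ⇒oneChange (x ∷ X) (y ∷ Y) (suc i , Xi≢Yi , unique) =
  subst (λ z → OneChange (x ∷ X) (z ∷ Y)) x≡y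
    (there (differ⇒oneChange X Y (i , Xi≢Yi , λ {j} ne → Fin.suc-injective (unique {suc j} ne))))
  where
  x≡y : x ≡ y
  x≡y = decidable-stable (x Fin.≟ y) λ x≢y → case unique {zero} x≢y of λ ()

oneChange⇒differ : ∀ {m} {X Y : Vec (Fin 3) m} → OneChange X Y → DifferInExactlyOne X Y
oneChange⇒differ (here x≢y) = zero , x≢y , λ { {zero} _ → refl ; {suc j} ne → contradiction refl ne }
oneChange⇒differ (there change) with oneChange⇒differ change
... | i , Xi≢Yi , unique = suc i , Xi≢Yi , λ { {zero} ne → contradiction refl ne ; {suc j} ne → cong suc (unique ne) }

differ? : ∀ {m} → Decidable (DifferInExactlyOne {m})
differ? X Y = any? λ i → ¬? (lookup X i Fin.≟ lookup Y i) ×-dec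
  map′ (λ f {j} → f j) (λ f j → f {j})
       (all? λ j → ¬? (lookup X j Fin.≟ lookup Y j) →-dec i Fin.≟ j)

mismatch : Fin 3 → Fin 3 → ℕ
mismatch x y with x Fin.≟ y
... | yes _ = 0
... | no  _ = 1

mismatch≤1 : ∀ x y → mismatch x y ≤ 1
mismatch≤1 x y with x Fin.≟ y
... | yes _ = z≤n
... | no  _ = ≤-refl

hamming : ∀ {m} → Vec (Fin 3) m → Vec (Fin 3) m → ℕ
hamming []      []      = 0
hamming (x ∷ X) (y ∷ Y) = mismatch x y + hamming X Y

hamming-refl : ∀ {m} (X : Vec (Fin 3) m) → hamming X X ≡ 0
hamming-refl [] = refl
hamming-refl (x ∷ X) with x Fin.≟ x
... | yes _  = hamming-refl X
... | no x≢x = contradiction refl x≢x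

hamming-replicate : ∀ m {x y} → x ≢ y → hamming (replicate m x) (replicate m y) ≡ m
hamming-replicate zero    x≢y = refl
hamming-replicate (suc m) {x} {y} x≢y with x Fin.≟ y
... | yes x≡y = contradiction x≡y x≢y
... | no  _   = cong suc (hamming-replicate m x≢y)

hamming-oneChange : ∀ {m} {X Y : Vec (Fin 3) m} Z → OneChange X Y → hamming X Z ≤ suc (hamming Y Z)
hamming-oneChange {X = x ∷ X} {y ∷ X} (z ∷ Z) (here _) =
  +-mono-≤ (mismatch≤1 x z) (m≤n+m (hamming X Z) (mismatch y z))
hamming-oneChange {X = x ∷ X} {x ∷ Y} (z ∷ Z) (there change) = begin
  mismatch x z + hamming X Z       ≤⟨ +-monoʳ-≤ (mismatch x z) (hamming-oneChange Z change) ⟩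
  mismatch x z + suc (hamming Y Z) ≡⟨ +-suc (mismatch x z) (hamming Y Z) ⟩
  suc (mismatch x z + hamming Y Z) ∎
  where open ≤-Reasoning

-- Serves to build walks that correct a single block; `map-walk` then carries them into the cube
-- without its faults.
Hamming : ℕ → Graph
Hamming m = record
  { Vertex = Vec (Fin 3) m
  ; Adj    = DifferInExactlyOne
  ; symm   = λ {X} {Y} → differ-sym X Y
  ; irrefl = λ {X} → differ-irrefl X
  }

-- Walks

map-walk : ∀ {G H} (f : Graph.Vertex G → Graph.Vertex H) →
           (∀ {x y} → Graph.Adj G x y → Graph.Adj H (f x) (f y)) →
           ∀ {x y k} → Walk G x y k → Walk H (f x) (f y) k
map-walk f f-adj nil           = nil
map-walk f f-adj (cons e walk) = cons (f-adj e) (map-walk f f-adj walk)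

_++ʷ_ : ∀ {G x y z k l} → Walk G x y k → Walk G y z l → Walk G x z (k + l)
nil         ++ʷ walk′ = walk′
cons e walk ++ʷ walk′ = cons e (walk ++ʷ walk′)

-- The drops of `Φ` telescope along the walk, and each edge contributes at most one.
walk-≥ : ∀ {G} (Φ : Graph.Vertex G → ℕ) → (∀ {x y} → Graph.Adj G x y → Φ x ≤ suc (Φ y)) →
         ∀ {x y k} → Walk G x y k → Φ x ≤ k + Φ y
walk-≥ Φ Φ-adj nil           = ≤-refl
walk-≥ Φ Φ-adj (cons e walk) = ≤-trans (Φ-adj e) (s≤s (walk-≥ Φ Φ-adj walk))

hamming-walk : ∀ {m} (X Y : Vec (Fin 3) m) → Walk (Hamming m) X Y (hamming X Y)
hamming-walk []      []      = nil
hamming-walk (x ∷ X) (y ∷ Y) with x Fin.≟ y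
... | yes refl = map-walk (x ∷_) (λ {X} {Y} e → oneChange⇒differ (there (differ⇒oneChange X Y e))) (hamming-walk X Y)
... | no  x≢y  = cons (oneChange⇒differ (here x≢y))
  (map-walk (y ∷_) (λ {X} {Y} e → oneChange⇒differ (there (differ⇒oneChange X Y e))) (hamming-walk X Y))

-- The exchanged 3-ary cube

_≟ᵛ_ : ∀ {m} → DecidableEquality (Vec (Fin 3) m)
_≟ᵛ_ = Vec.≡-dec Fin._≟_

E3CVertex-finite : ∀ r s t → Finite (E3CVertex r s t)
E3CVertex-finite r s t
  with finite-× (vec r) (finite-× (vec s) (finite-× (vec t) (3 , ↔-id (Fin 3))))
  where
  vec : ∀ m → Finite (Vec (Fin 3) m)
  vec = finite-Vec (3 , ↔-id (Fin 3))
... | n , blocks↔n = n , (blocks↔n ↔-∘ mk↔ₛ′ (λ x → let open E3CVertex x in A , B , C , d)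
                                           (λ (A , B , C , d) → ⟨ A , B , C , d ⟩)
                                           (λ _ → refl) (λ _ → refl))

E3CAdj? : ∀ {r s t} → Decidable (E3CAdj {r} {s} {t})
E3CAdj? ⟨ A , B , C , d ⟩ ⟨ A′ , B′ , C′ , d′ ⟩ =
  map′ (λ { (inj₁ (refl , refl , refl , d≢d′))                     → E0 d≢d′
          ; (inj₂ (inj₁ (refl , refl , refl , refl , p)))        → E1 p
          ; (inj₂ (inj₂ (inj₁ (refl , refl , refl , refl , p)))) → E2 p
          ; (inj₂ (inj₂ (inj₂ (refl , refl , refl , refl , p)))) → E3 p })
       (λ { (E0 d≢d′) → inj₁ (refl , refl , refl , d≢d′)
          ; (E1 p)    → inj₂ (inj₁ (refl , refl , refl , refl , p))
          ; (E2 p)    → inj₂ (inj₂ (inj₁ (refl , refl , refl , refl , p)))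
          ; (E3 p)    → inj₂ (inj₂ (inj₂ (refl , refl , refl , refl , p))) })
       ((A ≟ᵛ A′ ×-dec B ≟ᵛ B′ ×-dec C ≟ᵛ C′ ×-dec ¬? (d Fin.≟ d′)) ⊎-dec
        (d Fin.≟ 0F ×-dec d′ Fin.≟ 0F ×-dec A ≟ᵛ A′ ×-dec B ≟ᵛ B′ ×-dec differ? C C′) ⊎-dec
        (d Fin.≟ 1F ×-dec d′ Fin.≟ 1F ×-dec A ≟ᵛ A′ ×-dec C ≟ᵛ C′ ×-dec differ? B B′) ⊎-dec
        (d Fin.≟ 2F ×-dec d′ Fin.≟ 2F ×-dec B ≟ᵛ B′ ×-dec C ≟ᵛ C′ ×-dec differ? A A′))

-- The number of (E0) steps that a walk ending with last digit 2 still needs from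
-- last digit d when b digits of B and c digits of C remain to be corrected.
crossings : Fin 3 → ℕ → ℕ → ℕ
crossings 0F b       c       = suc (1 ⊓ b)
crossings 1F b       c       = suc (1 ⊓ c)
crossings 2F zero    zero    = 0
crossings 2F zero    (suc c) = 2
crossings 2F (suc b) zero    = 2
crossings 2F (suc b) (suc c) = 3

-- Only whether `b` and `c` vanish matters. After that split all values are numerals, and the nine
-- pairs of digits are checked by evaluation.
crossings-E0 : ∀ b c d d′ → crossings d b c ≤ suc (crossings d′ b c)
crossings-E0 zero    zero    = from-yes (all? λ d → all? λ d′ → crossings d 0 0 ≤? suc (crossings d′ 0 0))
crossings-E0 zero    (suc c) = from-yes (all? λ d → all? λ d′ → crossings d 0 (suc c) ≤? suc (crossings d′ 0 (suc c)))
crossings-E0 (suc b) zero    = from-yes (all? λ d → all? λ d′ → crossings d (suc b) 0 ≤? suc (crossings d′ (suc b) 0))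
crossings-E0 (suc b) (suc c) = from-yes (all? λ d → all? λ d′ → crossings d (suc b) (suc c) ≤? suc (crossings d′ (suc b) (suc c)))

-- A lower bound for the distance to `⟨ A₀ , B₀ , C₀ , 2F ⟩`: wrong coordinates plus the changes of
-- last digit still required.
potential : ∀ {r s t} → Vec (Fin 3) r → Vec (Fin 3) s → Vec (Fin 3) t → E3CVertex r s t → ℕ
potential A₀ B₀ C₀ ⟨ A , B , C , d ⟩ =
  hamming A A₀ + hamming B B₀ + hamming C C₀ + crossings d (hamming B B₀) (hamming C C₀)

-- An edge inside a block leaves `crossings` fixed: at digit 0, where C moves, it ignores `c`; at
-- digit 1, where B moves, it ignores `b`; at digit 2 only A moves.
potential-adj : ∀ {r s t} (A₀ : Vec (Fin 3) r) (B₀ : Vec (Fin 3) s) (C₀ : Vec (Fin 3) t) {x y} →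
                E3CAdj x y → potential A₀ B₀ C₀ x ≤ suc (potential A₀ B₀ C₀ y)
potential-adj A₀ B₀ C₀ (E0 {A} {B} {C} {d} {d′} _) = begin
  a + b + c + crossings d b c        ≤⟨ +-monoʳ-≤ (a + b + c) (crossings-E0 b c d d′) ⟩
  a + b + c + suc (crossings d′ b c) ≡⟨ +-suc (a + b + c) _ ⟩
  suc (a + b + c + crossings d′ b c) ∎
  where
  open ≤-Reasoning
  a = hamming A A₀
  b = hamming B B₀
  c = hamming C C₀
potential-adj A₀ B₀ C₀ (E1 {A} {B} {C} {C′} p) = +-monoˡ-≤ (suc (1 ⊓ b)) (begin
  a + b + hamming C C₀        ≤⟨ +-monoʳ-≤ (a + b) (hamming-oneChange C₀ (differ⇒oneChange C C′ p)) ⟩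
  a + b + suc (hamming C′ C₀) ≡⟨ +-suc (a + b) _ ⟩
  suc (a + b + hamming C′ C₀) ∎)
  where
  open ≤-Reasoning
  a = hamming A A₀
  b = hamming B B₀
potential-adj A₀ B₀ C₀ (E2 {A} {B} {B′} {C} p) = +-monoˡ-≤ (suc (1 ⊓ c)) (+-monoˡ-≤ c (begin
  a + hamming B B₀        ≤⟨ +-monoʳ-≤ a (hamming-oneChange B₀ (differ⇒oneChange B B′ p)) ⟩
  a + suc (hamming B′ B₀) ≡⟨ +-suc a _ ⟩
  suc (a + hamming B′ B₀) ∎))
  where
  open ≤-Reasoning
  a = hamming A A₀
  c = hamming C C₀
potential-adj A₀ B₀ C₀ (E3 {A} {A′} {B} {C} p) =
  +-monoˡ-≤ (crossings 2F (hamming B B₀) (hamming C C₀))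
    (+-monoˡ-≤ (hamming C C₀) (+-monoˡ-≤ (hamming B B₀) (hamming-oneChange A₀ (differ⇒oneChange A A′ p))))

potential-target : ∀ {r s t} (A₀ : Vec (Fin 3) r) (B₀ : Vec (Fin 3) s) (C₀ : Vec (Fin 3) t) →
                   potential A₀ B₀ C₀ ⟨ A₀ , B₀ , C₀ , 2F ⟩ ≡ 0
potential-target A₀ B₀ C₀ rewrite hamming-refl A₀ | hamming-refl B₀ | hamming-refl C₀ = refl

-- The faults

zeros ones : ∀ m → Vec (Fin 3) m
zeros m = replicate m 0F
ones  m = replicate m 1F

-- The entry with leading 2 stands first, so that the tail of `neighbours (suc r)` is
-- `neighboursExceptW` by definition.
neighbours : ∀ m → List (Vec (Fin 3) m)
neighbours zero    = []
neighbours (suc m) = (2F ∷ zeros m) ∷ (1F ∷ zeros m) ∷ map (0F ∷_) (neighbours m)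

neighbours-complete : ∀ {m} {X : Vec (Fin 3) m} → OneChange (zeros m) X → X ∈ neighbours m
neighbours-complete {suc m} (here {y = 0F} 0≢0) = contradiction refl 0≢0
neighbours-complete {suc m} (here {y = 1F} _)   = there (here refl)
neighbours-complete {suc m} (here {y = 2F} _)   = here refl
neighbours-complete {suc m} (there change)      = there (there (∈-map⁺ (0F ∷_) (neighbours-complete change)))

zeros∉neighbours : ∀ m → zeros m ∉ neighbours m
zeros∉neighbours (suc m) (there (there z∈)) with ∈-map⁻ (0F ∷_) z∈
... | _ , z∈′ , refl = zeros∉neighbours m z∈′

neighbours-unique : ∀ m → Unique (neighbours m)
neighbours-unique zero    = []
neighbours-unique (suc m) =
  ((λ ()) ∷ All.map⁺ (All.universal (λ _ ()) (neighbours m))) ∷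
  All.map⁺ (All.universal (λ _ ()) (neighbours m)) ∷
  map⁺ Vec.∷-injectiveʳ (neighbours-unique m)

length-neighbours : ∀ m → length (neighbours m) ≡ 2 * m
length-neighbours zero    = refl
length-neighbours (suc m) = begin
  2 + length (map (0F Vec.∷_) (neighbours m)) ≡⟨ cong (2 +_) (length-map (0F ∷_) (neighbours m)) ⟩
  2 + length (neighbours m)               ≡⟨ cong (2 +_) (length-neighbours m) ⟩
  2 + 2 * m                               ≡⟨ *-suc 2 m ⟨
  2 * suc m                               ∎
  where open ≡-Reasoning

module Faults (r s t : ℕ) where

  u v w : E3CVertex (suc r) (suc s) (suc t)
  u = ⟨ zeros _ , zeros _ , zeros _ , 2F ⟩
  v = ⟨ ones _ , ones _ , ones _ , 2F ⟩
  -- The leading 2 differs from the entry 1 of `v` as well as from 0, so the step from `u` to `w`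
  -- corrects nothing.
  w = ⟨ 2F ∷ zeros r , zeros _ , zeros _ , 2F ⟩

  embed : Vec (Fin 3) (suc r) → E3CVertex (suc r) (suc s) (suc t)
  embed A = ⟨ A , zeros _ , zeros _ , 2F ⟩

  neighboursExceptW : List (Vec (Fin 3) (suc r))
  neighboursExceptW = (1F ∷ zeros r) ∷ map (0F ∷_) (neighbours r)

  F : List (E3CVertex (suc r) (suc s) (suc t))
  F = ⟨ zeros _ , zeros _ , zeros _ , 0F ⟩ ∷ ⟨ zeros _ , zeros _ , zeros _ , 1F ⟩ ∷ map embed neighboursExceptW

  F-unique : Unique F
  F-unique =
    ((λ ()) ∷ All.map⁺ (All.universal (λ _ ()) neighboursExceptW)) ∷
    All.map⁺ (All.universal (λ _ ()) neighboursExceptW) ∷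
    map⁺ (cong E3CVertex.A) (AllPairs.tail (neighbours-unique (suc r)))

  length-F : length F ≡ 2 * suc r + 1
  length-F = begin
    2 + length (map embed neighboursExceptW) ≡⟨ cong (2 +_) (length-map embed neighboursExceptW) ⟩
    -- Two faults come from changing the last digit; one neighbour, `w`, is spared.
    1 + length (neighbours (suc r))          ≡⟨ cong suc (length-neighbours (suc r)) ⟩
    1 + 2 * suc r                            ≡⟨ +-comm 1 (2 * suc r) ⟩
    2 * suc r + 1                            ∎
    where open ≡-Reasoning

  u∉F : u ∉ F
  u∉F (there (there u∈)) with ∈-map⁻ embed u∈
  ... | _ , A∈ , refl = zeros∉neighbours (suc r) (there A∈)

  -- Block A of every fault starts with 0 or 1. This protects the walk while B and C are corrected.
  head≡2⇒∉F : ∀ {A B C d} → ⟨ 2F ∷ A , B , C , d ⟩ ∉ F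
  head≡2⇒∉F (there (there x∈)) with ∈-map⁻ embed x∈
  ... | _ , there A∈ , refl with ∈-map⁻ (0F ∷_) A∈
  ...   | _ , _ , ()

  -- Block C of every fault is zero, so A may change freely once C has been corrected.
  ones⇒∉F : ∀ {A B d} → ⟨ A , B , ones _ , d ⟩ ∉ F
  ones⇒∉F (there (there x∈)) with ∈-map⁻ embed x∈
  ... | _ , _ , ()

  -- At last digit 2 only (E0) and (E3) apply, and all the resulting neighbours except `w` were put
  -- into `F`.
  only-w : ∀ {x} → E3CAdj u x → x ∉ F → x ≡ w
  only-w (E0 {d′ = 0F} _)   x∉F = contradiction (here refl) x∉F
  only-w (E0 {d′ = 1F} _)   x∉F = contradiction (there (here refl)) x∉F
  only-w (E0 {d′ = 2F} 2≢2) x∉F = contradiction refl 2≢2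
  only-w (E3 {A′ = A′} p)   x∉F with neighbours-complete (differ⇒oneChange (zeros _) A′ p)
  ... | here refl = refl
  ... | there A∈  = contradiction (there (there (∈-map⁺ embed A∈))) x∉F

  -- The distance from `u` to `v` after removing the faults

  G∖F : Graph
  G∖F = E3C (suc r) (suc s) (suc t) ∖ F

  distance : ℕ
  distance = suc r + suc s + suc t + 4

  potential-w : potential (ones _) (ones _) (ones _) w ≡ suc r + suc s + suc t + 3
  potential-w
    rewrite hamming-replicate r {0F} {1F} (λ ())
          | hamming-replicate s {0F} {1F} (λ ())
          | hamming-replicate t {0F} {1F} (λ ()) = refl

  -- The first step is forced to `w`; the rest is at least as long as the potential at `w`, since
  -- the potential vanishes at `v`.
  distance-minimal : ∀ l → Walk G∖F (u , u∉F) (v , ones⇒∉F) l → distance ≤ l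
  distance-minimal (suc l) (cons {w = x , x∉F} u~x walk) with refl ← only-w u~x x∉F = begin
    suc r + suc s + suc t + 4       ≡⟨ +-suc (suc r + suc s + suc t) 3 ⟩
    suc (suc r + suc s + suc t + 3) ≡⟨ cong suc potential-w ⟨
    suc (Φ w)                       ≤⟨ s≤s (walk-≥ {G∖F} (Φ ∘ proj₁) (potential-adj (ones _) (ones _) (ones _)) walk) ⟩
    suc (l + Φ v)                   ≡⟨ cong (λ k → suc (l + k)) (potential-target (ones (suc r)) (ones (suc s)) (ones (suc t))) ⟩
    suc (l + 0)                     ≡⟨ cong suc (+-identityʳ l) ⟩
    suc l                           ∎
    where
    open ≤-Reasoning
    Φ = potential (ones (suc r)) (ones (suc s)) (ones (suc t))

  fix-C : Walk G∖F (⟨ 2F ∷ zeros r , zeros _ , zeros _ , 0F ⟩ , head≡2⇒∉F)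
                   (⟨ 2F ∷ zeros r , zeros _ , ones _ , 0F ⟩ , head≡2⇒∉F)
                   (hamming (zeros (suc t)) (ones (suc t)))
  fix-C = map-walk {H = G∖F} (λ C → ⟨ 2F ∷ zeros r , zeros _ , C , 0F ⟩ , head≡2⇒∉F) E1
            (hamming-walk (zeros (suc t)) (ones (suc t)))

  fix-B : Walk G∖F (⟨ 2F ∷ zeros r , zeros _ , ones _ , 1F ⟩ , head≡2⇒∉F)
                   (⟨ 2F ∷ zeros r , ones _ , ones _ , 1F ⟩ , head≡2⇒∉F)
                   (hamming (zeros (suc s)) (ones (suc s)))
  fix-B = map-walk {H = G∖F} (λ B → ⟨ 2F ∷ zeros r , B , ones _ , 1F ⟩ , head≡2⇒∉F) E2
            (hamming-walk (zeros (suc s)) (ones (suc s)))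

  fix-A : Walk G∖F (⟨ 2F ∷ zeros r , ones _ , ones _ , 2F ⟩ , ones⇒∉F) (v , ones⇒∉F)
                   (hamming (2F ∷ zeros r) (ones (suc r)))
  fix-A = map-walk {H = G∖F} (λ A → ⟨ A , ones _ , ones _ , 2F ⟩ , ones⇒∉F) E3
            (hamming-walk (2F ∷ zeros r) (ones (suc r)))

  -- The last digit runs through 2, 0, 1, 2, with C corrected at 0, B at 1 and A at the final 2.
  -- Leaving A for the end keeps its leading 2 until C is all ones.
  walk-uv : Walk G∖F (u , u∉F) (v , ones⇒∉F) distance
  walk-uv = subst (Walk G∖F (u , u∉F) (v , ones⇒∉F)) lengths
    (cons {w = w , head≡2⇒∉F} (E3 (oneChange⇒differ (here λ ())))
      (cons (E0 λ ()) (fix-C ++ʷ cons (E0 λ ()) (fix-B ++ʷ cons (E0 λ ()) fix-A))))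
    where
    -- The 4 collects the detour to `w` and the three changes of last digit.
    rearrange : ∀ a b c → 2 + (c + (1 + (b + (1 + a)))) ≡ a + b + c + 4
    rearrange = solve-∀
    lengths : 2 + (hamming (zeros (suc t)) (ones (suc t)) + (1 + (hamming (zeros (suc s)) (ones (suc s)) +
                (1 + hamming (2F ∷ zeros r) (ones (suc r)))))) ≡ distance
    lengths
      rewrite hamming-replicate r {0F} {1F} (λ ())
            | hamming-replicate s {0F} {1F} (λ ())
            | hamming-replicate t {0F} {1F} (λ ()) = rearrange (suc r) (suc s) (suc t)

  faultDistance : FaultDistance (E3C _ _ _) (2 * suc r + 1) distance
  faultDistance = u , v , (λ ()) , F , F-unique , length-F , u∉F , ones⇒∉F , walk-uv , distance-minimal

theorem1 : (r s t n : ℕ) → 1 ≤ r → r ≤ s → s ≤ t → n ≡ r + s + t + 1 →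
    ∃[ D ] (IsFaultDiameter (E3C r s t) (2 * r + 1) D × D ≥ r + s + t + 4 × r + s + t + 4 ≡ n + 3)
-- The inequalities make all three block lengths positive, as the construction in `Faults` requires.
theorem1 r@(suc r′) s@(suc s′) t@(suc t′) n _ _ _ refl =
  map₂ (λ (D-isDiameter , D≥) → D-isDiameter , D≥ , sym (+-assoc (r + s + t) 1 3))
    (FiniteGraph.faultDiameter-≥ (E3C r s t) (E3CVertex-finite r s t) E3CAdj? (2 * r + 1)
      (Faults.faultDistance r′ s′ t′))
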